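{- Let $H$ be a complex Hadamard matrix, let $\{C_1,\dots,C_t\}$ be a partition of the set of columns of $H$, and let $\{R,R_1\}$ be a partition of the set of rows of $H$. For $1\le i\le t$ let $M_{1i}$ denote the submatrix of $H$ with rows $R_1$ and columns $C_i$. Suppose that for all $i\neq j$, every column of $M_{1i}$ is orthogonal (with respect to the standard Hermitian inner product) to every column of $M_{1j}$. Then for any choice of $a_1,\dots,a_t\in\mathbb{T}$, the matrix obtained from $H$ by replacing each $M_{1i}$ by $a_iM_{1i}$ (all other entries unchanged) is a complex Hadamard matrix. In particular, for any single index $i$ and any $a\in\mathbb{T}$, replacing $M_{1i}$ by $aM_{1i}$ yields a complex Hadamard matrix.
   Context: $\mathbb{T}$ is the set of complex numbers of modulus $1$. A complex Hadamard matrix of order $n$ is an $n\times n$ matrix $H$ with all entries in $\mathbb{T}$ and $HH^{\ast}=nI_n$ (equivalently, its columns are pairwise orthogonal). -}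

module Defs where

open import Algebra.Bundles using (CommutativeMonoid)
open import Algebra.Bundles.Raw using (RawRing)
open import Data.Bool.Base using (if_then_else_; _∧_)
open import Data.Fin.Base using (Fin; zero; suc)
open import Data.Fin.Properties using (_≟_)
open import Data.Fin.Subset
  using (Subset; inside; outside; _∈_; _∩_; Nonempty; Empty; ∣_∣)
open import Data.Fin.Subset.Properties using (_∈?_)
open import Data.Nat.Base as ℕ using (ℕ)
import Data.Nat.Properties as ℕ
open import Data.Product.Base using (∃; _×_; _,_; proj₁)
open import Data.Rational.Base as ℚ using (ℚ; 0ℚ; 1ℚ)
import Data.Rational.Properties as ℚ
open import Algebra.Properties.CommutativeSemigroup
  (CommutativeMonoid.commutativeSemigroup ℚ.+-0-commutativeMonoid) using (interchange)
open import Algebra.Properties.Ring ℚ.+-*-ring using (x[y-z]≈xy-xz; [y-z]x≈yx-zx)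
open import Data.Vec.Base as Vec using ()
open import Data.Vec.Functional using (Vector)
open import Level using (0ℓ)
open import Relation.Binary.PropositionalEquality
  using (_≡_; _≢_; refl; sym; trans; cong; cong₂; subst)
open import Relation.Nullary.Decidable.Core using (⌊_⌋)

------------------------------------------------------------------------
-- Real numbers: Cauchy sequences of rationals, with the setoid equality
-- "the difference tends to 0".

Eventually : (ℕ → Set) → Set
Eventually P = ∃ λ N → ∀ n → N ℕ.≤ n → P n

IsCauchy : (ℕ → ℚ) → Set
IsCauchy s = ∀ ε → 0ℚ ℚ.< ε →
  ∃ λ N → ∀ m n → N ℕ.≤ m → N ℕ.≤ n → ℚ.∣ s m ℚ.- s n ∣ ℚ.≤ ε

record ℝ : Set where
  constructor mkℝ
  field
    seq    : ℕ → ℚ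
    cauchy : IsCauchy seq

open ℝ public

infix 4 _≈ℝ_ _≤ℝ_

-- Records rather than plain definitions, so that Agda can infer x and y.
record _≈ℝ_ (x y : ℝ) : Set where
  constructor mk≈ℝ
  field
    close : ∀ ε → 0ℚ ℚ.< ε →
            Eventually λ n → ℚ.∣ seq x n ℚ.- seq y n ∣ ℚ.≤ ε

record _≤ℝ_ (x y : ℝ) : Set where
  constructor mk≤ℝ
  field
    below : ∀ ε → 0ℚ ℚ.< ε → Eventually λ n → seq x n ℚ.≤ seq y n ℚ.+ ε

abstract
  const-cauchy : ∀ q → IsCauchy (λ _ → q)
  const-cauchy q ε 0<ε = 0 , λ _ _ _ _ →
    subst (λ d → ℚ.∣ d ∣ ℚ.≤ ε) (sym (ℚ.+-inverseʳ q)) (ℚ.<⇒≤ 0<ε)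

  neg-cauchy : ∀ s → IsCauchy s → IsCauchy (λ n → ℚ.- s n)
  neg-cauchy s cs ε 0<ε with cs ε 0<ε
  ... | N , h = N , λ m n N≤m N≤n →
    subst (ℚ._≤ ε)
      (trans (sym (ℚ.∣-p∣≡∣p∣ (s m ℚ.- s n)))
             (cong ℚ.∣_∣ (ℚ.neg-distrib-+ (s m) (ℚ.- s n))))
      (h m n N≤m N≤n)

  quotient : ∀ ε → 0ℚ ℚ.< ε → ∀ B → 0ℚ ℚ.< B →
             ∃ λ δ → 0ℚ ℚ.< δ × B ℚ.* δ ≡ ε
  quotient ε 0<ε B 0<B =
    let instance
          posε   = ℚ.positive 0<ε
          posB   = ℚ.positive 0<B
          B≢0    = ℚ.pos⇒nonZero B
          pos1/B = ℚ.1/pos⇒pos B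
        δ = ℚ.1/ B ℚ.* ε
    in δ , ℚ.positive⁻¹ δ {{ℚ.pos*pos⇒pos (ℚ.1/ B) ε}} ,
       trans (sym (ℚ.*-assoc B (ℚ.1/ B) ε))
         (trans (cong (ℚ._* ε) (ℚ.*-inverseʳ B)) (ℚ.*-identityˡ ε))

  +-cauchy : ∀ s t → IsCauchy s → IsCauchy t → IsCauchy (λ n → s n ℚ.+ t n)
  +-cauchy s t cs ct ε 0<ε
    with quotient ε 0<ε (1ℚ ℚ.+ 1ℚ) (ℚ.positive⁻¹ (1ℚ ℚ.+ 1ℚ))
  ... | δ , 0<δ , 2δ≡ε with cs δ 0<δ | ct δ 0<δ
  ... | N , h | M , k = N ℕ.⊔ M , λ m n l₁ l₂ → begin
      ℚ.∣ (s m ℚ.+ t m) ℚ.- (s n ℚ.+ t n) ∣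
        ≡⟨ cong ℚ.∣_∣ (regroup (s m) (t m) (s n) (t n)) ⟩
      ℚ.∣ (s m ℚ.- s n) ℚ.+ (t m ℚ.- t n) ∣
        ≤⟨ ℚ.∣p+q∣≤∣p∣+∣q∣ (s m ℚ.- s n) (t m ℚ.- t n) ⟩
      ℚ.∣ s m ℚ.- s n ∣ ℚ.+ ℚ.∣ t m ℚ.- t n ∣
        ≤⟨ ℚ.+-mono-≤ (h m n (ℕ.m⊔n≤o⇒m≤o N M l₁) (ℕ.m⊔n≤o⇒m≤o N M l₂))
                      (k m n (ℕ.m⊔n≤o⇒n≤o N M l₁) (ℕ.m⊔n≤o⇒n≤o N M l₂)) ⟩
      δ ℚ.+ δ
        ≡⟨ cong₂ ℚ._+_ (ℚ.*-identityˡ δ) (ℚ.*-identityˡ δ) ⟨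
      1ℚ ℚ.* δ ℚ.+ 1ℚ ℚ.* δ
        ≡⟨ ℚ.*-distribʳ-+ δ 1ℚ 1ℚ ⟨
      (1ℚ ℚ.+ 1ℚ) ℚ.* δ
        ≡⟨ 2δ≡ε ⟩
      ε ∎
    where
    open ℚ.≤-Reasoning
    regroup : ∀ a b c d → (a ℚ.+ b) ℚ.- (c ℚ.+ d) ≡ (a ℚ.- c) ℚ.+ (b ℚ.- d)
    regroup a b c d = trans
      (cong ((a ℚ.+ b) ℚ.+_) (ℚ.neg-distrib-+ c d))
      (interchange a b (ℚ.- c) (ℚ.- d))

  cancel : ∀ a b → (a ℚ.- b) ℚ.+ b ≡ a
  cancel a b = trans (ℚ.+-assoc a (ℚ.- b) b)
    (trans (cong (a ℚ.+_) (ℚ.+-inverseˡ b)) (ℚ.+-identityʳ a))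

  cauchy⇒bounded : ∀ s → IsCauchy s →
    ∃ λ B → 0ℚ ℚ.< B × Eventually λ n → ℚ.∣ s n ∣ ℚ.≤ B
  cauchy⇒bounded s cs with cs 1ℚ (ℚ.positive⁻¹ 1ℚ)
  ... | N , h = 1ℚ ℚ.+ ℚ.∣ s N ∣ , 0<B , N , λ n N≤n → begin
      ℚ.∣ s n ∣
        ≡⟨ cong ℚ.∣_∣ (cancel (s n) (s N)) ⟨
      ℚ.∣ (s n ℚ.- s N) ℚ.+ s N ∣
        ≤⟨ ℚ.∣p+q∣≤∣p∣+∣q∣ (s n ℚ.- s N) (s N) ⟩
      ℚ.∣ s n ℚ.- s N ∣ ℚ.+ ℚ.∣ s N ∣
        ≤⟨ ℚ.+-monoˡ-≤ ℚ.∣ s N ∣ (h n N N≤n ℕ.≤-refl) ⟩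
      1ℚ ℚ.+ ℚ.∣ s N ∣ ∎
    where
    open ℚ.≤-Reasoning
    0<B : 0ℚ ℚ.< 1ℚ ℚ.+ ℚ.∣ s N ∣
    0<B = ℚ.positive⁻¹ (1ℚ ℚ.+ ℚ.∣ s N ∣)
            {{ℚ.pos+nonNeg⇒pos 1ℚ ℚ.∣ s N ∣ {{ℚ.∣-∣-nonNeg (s N)}}}}

  *-cauchy : ∀ s t → IsCauchy s → IsCauchy t → IsCauchy (λ n → s n ℚ.* t n)
  *-cauchy s t cs ct ε 0<ε with cauchy⇒bounded s cs | cauchy⇒bounded t ct
  ... | A , 0<A , N₁ , boundA | B , 0<B , N₂ , boundB
    with quotient ε 0<ε (A ℚ.+ B) (ℚ.+-mono-< 0<A 0<B)
  ... | δ , 0<δ , eq with cs δ 0<δ | ct δ 0<δ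
  ... | N₃ , h | N₄ , k = (N₁ ℕ.⊔ N₂) ℕ.⊔ (N₃ ℕ.⊔ N₄) , λ m n l₁ l₂ →
    let (A≤m , _ , s≤m , t≤m) = maximum₄ N₁ N₂ N₃ N₄ m l₁
        (_ , B≤n , s≤n , t≤n) = maximum₄ N₁ N₂ N₃ N₄ n l₂
    in begin
      ℚ.∣ s m ℚ.* t m ℚ.- s n ℚ.* t n ∣
        ≡⟨ cong ℚ.∣_∣ (regroup (s m) (t m) (s n) (t n)) ⟨
      ℚ.∣ s m ℚ.* (t m ℚ.- t n) ℚ.+ (s m ℚ.- s n) ℚ.* t n ∣
        ≤⟨ ℚ.∣p+q∣≤∣p∣+∣q∣ (s m ℚ.* (t m ℚ.- t n)) ((s m ℚ.- s n) ℚ.* t n) ⟩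
      ℚ.∣ s m ℚ.* (t m ℚ.- t n) ∣ ℚ.+ ℚ.∣ (s m ℚ.- s n) ℚ.* t n ∣
        ≤⟨ ℚ.+-mono-≤
             (bound (s m) (t m ℚ.- t n) A δ 0<A (boundA m A≤m) (k m n t≤m t≤n))
             (bound (s m ℚ.- s n) (t n) δ B 0<δ (h m n s≤m s≤n) (boundB n B≤n)) ⟩
      A ℚ.* δ ℚ.+ δ ℚ.* B
        ≡⟨ cong (A ℚ.* δ ℚ.+_) (ℚ.*-comm δ B) ⟩
      A ℚ.* δ ℚ.+ B ℚ.* δ
        ≡⟨ ℚ.*-distribʳ-+ δ A B ⟨
      (A ℚ.+ B) ℚ.* δ
        ≡⟨ eq ⟩
      ε ∎
    where
    open ℚ.≤-Reasoning
    maximum₄ : ∀ a b c d k → (a ℕ.⊔ b) ℕ.⊔ (c ℕ.⊔ d) ℕ.≤ k →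
               a ℕ.≤ k × b ℕ.≤ k × c ℕ.≤ k × d ℕ.≤ k
    maximum₄ a b c d k l =
      let l₁ = ℕ.m⊔n≤o⇒m≤o (a ℕ.⊔ b) (c ℕ.⊔ d) l
          l₂ = ℕ.m⊔n≤o⇒n≤o (a ℕ.⊔ b) (c ℕ.⊔ d) l
      in ℕ.m⊔n≤o⇒m≤o a b l₁ , ℕ.m⊔n≤o⇒n≤o a b l₁ ,
         ℕ.m⊔n≤o⇒m≤o c d l₂ , ℕ.m⊔n≤o⇒n≤o c d l₂
    regroup : ∀ a b c d →
      a ℚ.* (b ℚ.- d) ℚ.+ (a ℚ.- c) ℚ.* d ≡ a ℚ.* b ℚ.- c ℚ.* d
    regroup a b c d = trans
      (cong₂ ℚ._+_ (x[y-z]≈xy-xz a b d) ([y-z]x≈yx-zx d a c))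
      (trans (sym (ℚ.+-assoc (a ℚ.* b ℚ.- a ℚ.* d) (a ℚ.* d) (ℚ.- (c ℚ.* d))))
             (cong (ℚ._- c ℚ.* d) (cancel (a ℚ.* b) (a ℚ.* d))))
    bound : ∀ p q P Q → 0ℚ ℚ.< P → ℚ.∣ p ∣ ℚ.≤ P → ℚ.∣ q ∣ ℚ.≤ Q →
            ℚ.∣ p ℚ.* q ∣ ℚ.≤ P ℚ.* Q
    bound p q P Q 0<P p≤P q≤Q = begin
      ℚ.∣ p ℚ.* q ∣
        ≡⟨ ℚ.∣p*q∣≡∣p∣*∣q∣ p q ⟩
      ℚ.∣ p ∣ ℚ.* ℚ.∣ q ∣
        ≤⟨ ℚ.*-monoʳ-≤-nonNeg ℚ.∣ q ∣ {{ℚ.∣-∣-nonNeg q}} p≤P ⟩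
      P ℚ.* ℚ.∣ q ∣
        ≤⟨ ℚ.*-monoˡ-≤-nonNeg P {{ℚ.nonNegative (ℚ.<⇒≤ 0<P)}} q≤Q ⟩
      P ℚ.* Q ∎

infixl 6 _+ℝ_
infixl 7 _*ℝ_
infix  8 -ℝ_

_+ℝ_ _*ℝ_ : ℝ → ℝ → ℝ
x +ℝ y = mkℝ (λ n → seq x n ℚ.+ seq y n)
             (+-cauchy (seq x) (seq y) (cauchy x) (cauchy y))
x *ℝ y = mkℝ (λ n → seq x n ℚ.* seq y n)
             (*-cauchy (seq x) (seq y) (cauchy x) (cauchy y))

-ℝ_ : ℝ → ℝ
-ℝ x = mkℝ (λ n → ℚ.- seq x n) (neg-cauchy (seq x) (cauchy x))

0ℝ 1ℝ : ℝ
0ℝ = mkℝ (λ _ → 0ℚ) (const-cauchy 0ℚ)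
1ℝ = mkℝ (λ _ → 1ℚ) (const-cauchy 1ℚ)

------------------------------------------------------------------------
-- Complex numbers

record ℂ : Set where
  constructor _+i_
  field
    re im : ℝ

open ℂ public

record _≈ℂ_ (w z : ℂ) : Set where
  constructor mk≈ℂ
  field
    re-≈ : re w ≈ℝ re z
    im-≈ : im w ≈ℝ im z

ℂ-rawRing : RawRing 0ℓ 0ℓ
ℂ-rawRing = record
  { Carrier = ℂ
  ; _≈_     = _≈ℂ_
  ; _+_     = λ w z → (re w +ℝ re z) +i (im w +ℝ im z)
  ; _*_     = λ w z → (re w *ℝ re z +ℝ -ℝ (im w *ℝ im z))
                      +i (re w *ℝ im z +ℝ im w *ℝ re z)
  ; -_      = λ z → (-ℝ re z) +i (-ℝ im z)
  ; 0#      = 0ℝ +i 0ℝ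
  ; 1#      = 1ℝ +i 0ℝ
  }

open RawRing ℂ-rawRing public
  using (_≈_; _+_; _*_; -_)
  renaming (0# to 0ℂ; 1# to 1ℂ)

open import Algebra.Definitions.RawMonoid (RawRing.+-rawMonoid ℂ-rawRing) public
  using (sum)
  renaming (_×_ to _·_)

conj : ℂ → ℂ
conj z = re z +i (-ℝ im z)

-- r is the nonnegative square root of (re z)² + (im z)², i.e. |z| = r.
HasModulus : ℂ → ℝ → Set
HasModulus z r = 0ℝ ≤ℝ r × r *ℝ r ≈ℝ re z *ℝ re z +ℝ im z *ℝ im z

𝕋 : ℂ → Set
𝕋 z = HasModulus z 1ℝ

------------------------------------------------------------------------
-- Matrices

Matrix : ℕ → ℕ → Set
Matrix m n = Fin m → Fin n → ℂ

infix  4 _≈ᴹ_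
infixl 7 _*ᴹ_
infix  8 _ᴴ

_≈ᴹ_ : ∀ {m n} → Matrix m n → Matrix m n → Set
A ≈ᴹ B = ∀ i j → A i j ≈ B i j

_*ᴹ_ : ∀ {m n p} → Matrix m n → Matrix n p → Matrix m p
(A *ᴹ B) i j = sum λ k → A i k * B k j

_ᴴ : ∀ {m n} → Matrix m n → Matrix n m
(A ᴴ) i j = conj (A j i)

scalar : ∀ {n} → ℂ → Matrix n n
scalar z i j = if ⌊ i ≟ j ⌋ then z else 0ℂ

column : ∀ {m n} → Matrix m n → Fin n → Vector ℂ m
column A j i = A i j

⟨_,_⟩ : ∀ {n} → Vector ℂ n → Vector ℂ n → ℂ
⟨ u , v ⟩ = sum λ k → u k * conj (v k)

_⊥_ : ∀ {n} → Vector ℂ n → Vector ℂ n → Set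
u ⊥ v = ⟨ u , v ⟩ ≈ 0ℂ

record IsHadamard {n} (H : Matrix n n) : Set where
  field
    entries : ∀ i j → 𝕋 (H i j)
    -- n · 1ℂ is the n-fold sum 1 + ⋯ + 1.
    HHᴴ≈nI  : H *ᴹ H ᴴ ≈ᴹ scalar (n · 1ℂ)

------------------------------------------------------------------------
-- Partitions and blocks

record IsPartition {n t} (S : Vector (Subset n) t) : Set where
  field
    nonempty : ∀ i → Nonempty (S i)
    disjoint : ∀ i j → i ≢ j → Empty (S i ∩ S j)
    covers   : ∀ x → ∃ λ i → x ∈ S i

  -- The index of the part containing x; unique by disjointness.
  part : Fin n → Fin t
  part x = proj₁ (covers x)

-- The elements of a subset in increasing order.
elements : ∀ {n} (S : Subset n) → Vector (Fin n) ∣ S ∣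
elements (inside  Vec.∷ S) zero    = zero
elements (inside  Vec.∷ S) (suc k) = suc (elements S k)
elements (outside Vec.∷ S) k       = suc (elements S k)

submatrix : ∀ {m n} → Matrix m n → (R : Subset m) (C : Subset n) →
            Matrix ∣ R ∣ ∣ C ∣
submatrix H R C k l = H (elements R k) (elements C l)

-- Replace the submatrix M with rows R and columns C by z M.
scaleBlock : ∀ {m n} → Matrix m n → Subset m → Subset n → ℂ → Matrix m n
scaleBlock H R C z r c =
  if ⌊ r ∈? R ⌋ ∧ ⌊ c ∈? C ⌋ then z * H r c else H r c

-- For every i, replace the submatrix Mᵢ with rows R and columns C i by a i Mᵢ.
scaleBlocks : ∀ {m n t} → Matrix m n → Subset m →
              {C : Vector (Subset n) t} → IsPartition C →
              Vector ℂ t → Matrix m n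
scaleBlocks H R C-partition a r c =
  if ⌊ r ∈? R ⌋ then a (part c) * H r c else H r c
  where open IsPartition C-partition

{-# OPTIONS --safe #-}

-- Both modifications multiply the rows in R₁ by a unimodular diagonal matrix W
-- that is constant on the parts C i.  Write A for the rows of H in R₁ and B for
-- a row outside R₁.  Inner products of two rows on the same side of the
-- partition do not change, so only A W Bᴴ = 0 is at stake.  By the
-- orthogonality hypothesis the Gram matrix Aᴴ A vanishes between different
-- parts, hence commutes with W, and
--   n A W Bᴴ = A Aᴴ A W Bᴴ = A W Aᴴ A Bᴴ = 0.
-- This uses only A Aᴴ = n I, so one never needs that the columns of H are
-- orthogonal as well.
module Submission where

open import Defs
open import Data.Fin.Base using (Fin)
open import Data.Fin.Subset using (Subset)
open import Data.Nat.Base using (ℕ)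
open import Data.Product.Base using (_×_)
open import Data.Vec.Functional using (Vector; _∷_; [])
open import Relation.Binary.PropositionalEquality using (_≢_)

open import Algebra.Bundles using (CommutativeRing)
import Algebra.Properties.CommutativeSemigroup as CommutativeSemigroupProperties
import Algebra.Properties.Semiring.Sum as SemiringSum
open import Data.Bool.Base using (if_then_else_)
open import Data.Fin.Base using (zero; suc)
open import Data.Fin.Properties using (_≟_; suc-injective)
open import Data.Fin.Subset using (inside; outside; _∈_; _∉_; ∣_∣)
open import Data.Fin.Subset.Properties using (_∈?_; drop-there; x∈p∩q⁺)
open import Data.Nat.Base as ℕ using (zero; suc)
import Data.Nat.Properties as ℕ
open import Data.Product.Base using (∃; _,_; proj₁; proj₂)
open import Data.Rational.Base as ℚ using (ℚ; 0ℚ; 1ℚ)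
import Data.Rational.Properties as ℚ
open import Data.Rational.Solver using (module +-*-Solver)
open import Data.Sum.Base using (_⊎_; inj₁; inj₂)
open import Data.Vec.Base as Vec using ()
open import Function.Base using (_∘_)
open import Level using (0ℓ)
open import Relation.Binary.PropositionalEquality
  using (_≡_; refl; sym; trans; cong; subst; subst₂)
import Relation.Binary.Reasoning.Setoid as SetoidReasoning
open import Relation.Nullary using (yes; no; contradiction)
open import Relation.Nullary.Decidable using (⌊_⌋)

open +-*-Solver

-- Null sequences of rationals.

IsNull : (ℕ → ℚ) → Set
IsNull s = ∀ ε → 0ℚ ℚ.< ε → Eventually λ n → ℚ.∣ s n ∣ ℚ.≤ ε

null-resp-≗ : ∀ {s t} → (∀ n → s n ≡ t n) → IsNull s → IsNull t
null-resp-≗ s≗t s→0 ε 0<ε with s→0 ε 0<ε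
... | N , h = N , λ n N≤n → subst (λ q → ℚ.∣ q ∣ ℚ.≤ ε) (s≗t n) (h n N≤n)

null-const : IsNull (λ _ → 0ℚ)
null-const ε 0<ε = 0 , λ _ _ → ℚ.<⇒≤ 0<ε

null-neg : ∀ {s} → IsNull s → IsNull (λ n → ℚ.- s n)
null-neg {s} s→0 ε 0<ε with s→0 ε 0<ε
... | N , h = N , λ n N≤n → subst (ℚ._≤ ε) (sym (ℚ.∣-p∣≡∣p∣ (s n))) (h n N≤n)

null-+ : ∀ {s t} → IsNull s → IsNull t → IsNull (λ n → s n ℚ.+ t n)
null-+ {s} {t} s→0 t→0 ε 0<ε
  with quotient ε 0<ε (1ℚ ℚ.+ 1ℚ) (ℚ.positive⁻¹ (1ℚ ℚ.+ 1ℚ))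
... | δ , 0<δ , 2δ≡ε with s→0 δ 0<δ | t→0 δ 0<δ
... | N , h | M , k = N ℕ.⊔ M , λ n l → begin
    ℚ.∣ s n ℚ.+ t n ∣
      ≤⟨ ℚ.∣p+q∣≤∣p∣+∣q∣ (s n) (t n) ⟩
    ℚ.∣ s n ∣ ℚ.+ ℚ.∣ t n ∣
      ≤⟨ ℚ.+-mono-≤ (h n (ℕ.m⊔n≤o⇒m≤o N M l)) (k n (ℕ.m⊔n≤o⇒n≤o N M l)) ⟩
    δ ℚ.+ δ
      ≡⟨ solve 1 (λ d → d :+ d := (con 1ℚ :+ con 1ℚ) :* d) refl δ ⟩
    (1ℚ ℚ.+ 1ℚ) ℚ.* δ
      ≡⟨ 2δ≡ε ⟩
    ε ∎
  where open ℚ.≤-Reasoning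

-- A Cauchy sequence is eventually bounded by some `B`, so it suffices to make `s` smaller than ε
-- divided by `B`.
null-*-cauchy : ∀ {s t} → IsNull s → IsCauchy t → IsNull (λ n → s n ℚ.* t n)
null-*-cauchy {s} {t} s→0 ct ε 0<ε with cauchy⇒bounded t ct
... | B , 0<B , M , bounded with quotient ε 0<ε B 0<B
... | δ , 0<δ , Bδ≡ε with s→0 δ 0<δ
... | N , h = N ℕ.⊔ M , λ n l → begin
    ℚ.∣ s n ℚ.* t n ∣
      ≡⟨ ℚ.∣p*q∣≡∣p∣*∣q∣ (s n) (t n) ⟩
    ℚ.∣ s n ∣ ℚ.* ℚ.∣ t n ∣
      ≤⟨ ℚ.*-monoˡ-≤-nonNeg ℚ.∣ s n ∣ {{ℚ.∣-∣-nonNeg (s n)}}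
           (bounded n (ℕ.m⊔n≤o⇒n≤o N M l)) ⟩
    ℚ.∣ s n ∣ ℚ.* B
      ≤⟨ ℚ.*-monoʳ-≤-nonNeg B {{ℚ.nonNegative (ℚ.<⇒≤ 0<B)}}
           (h n (ℕ.m⊔n≤o⇒m≤o N M l)) ⟩
    δ ℚ.* B
      ≡⟨ ℚ.*-comm δ B ⟩
    B ℚ.* δ
      ≡⟨ Bδ≡ε ⟩
    ε ∎
  where open ℚ.≤-Reasoning

-- Equality of reals as a congruence.

null⇒≈ℝ : ∀ {x y} → IsNull (λ n → seq x n ℚ.- seq y n) → x ≈ℝ y
null⇒≈ℝ = mk≈ℝ

≈ℝ⇒null : ∀ {x y} → x ≈ℝ y → IsNull (λ n → seq x n ℚ.- seq y n)
≈ℝ⇒null = _≈ℝ_.close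

-- Real arithmetic acts termwise on sequences, so through this lemma every polynomial identity over
-- the reals becomes one over the rationals, within reach of the ring solver.
pointwise : ∀ {x y} → (∀ n → seq x n ≡ seq y n) → x ≈ℝ y
pointwise {x} {y} x≗y = null⇒≈ℝ (null-resp-≗
  (λ n → sym (trans (cong (ℚ._- seq y n) (x≗y n)) (ℚ.+-inverseʳ (seq y n))))
  null-const)

≈ℝ-refl : ∀ {x} → x ≈ℝ x
≈ℝ-refl = pointwise λ _ → refl

≈ℝ-sym : ∀ {x y} → x ≈ℝ y → y ≈ℝ x
≈ℝ-sym {x} {y} x≈y = null⇒≈ℝ (null-resp-≗
  (λ n → solve 2 (λ a b → :- (a :- b) := b :- a) refl (seq x n) (seq y n))
  (null-neg (≈ℝ⇒null x≈y)))

≈ℝ-trans : ∀ {x y z} → x ≈ℝ y → y ≈ℝ z → x ≈ℝ z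
≈ℝ-trans {x} {y} {z} x≈y y≈z = null⇒≈ℝ (null-resp-≗
  (λ n → solve 3 (λ a b c → (a :- b) :+ (b :- c) := a :- c) refl
           (seq x n) (seq y n) (seq z n))
  (null-+ (≈ℝ⇒null x≈y) (≈ℝ⇒null y≈z)))

+ℝ-cong : ∀ {x x′ y y′} → x ≈ℝ x′ → y ≈ℝ y′ → (x +ℝ y) ≈ℝ (x′ +ℝ y′)
+ℝ-cong {x} {x′} {y} {y′} x≈x′ y≈y′ = null⇒≈ℝ (null-resp-≗
  (λ n → solve 4 (λ a a′ b b′ → (a :- a′) :+ (b :- b′) := (a :+ b) :- (a′ :+ b′))
           refl (seq x n) (seq x′ n) (seq y n) (seq y′ n))
  (null-+ (≈ℝ⇒null x≈x′) (≈ℝ⇒null y≈y′)))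

-ℝ-cong : ∀ {x y} → x ≈ℝ y → (-ℝ x) ≈ℝ (-ℝ y)
-ℝ-cong {x} {y} x≈y = null⇒≈ℝ (null-resp-≗
  (λ n → solve 2 (λ a b → :- (a :- b) := (:- a) :- (:- b)) refl (seq x n) (seq y n))
  (null-neg (≈ℝ⇒null x≈y)))

*ℝ-cong : ∀ {x x′ y y′} → x ≈ℝ x′ → y ≈ℝ y′ → (x *ℝ y) ≈ℝ (x′ *ℝ y′)
*ℝ-cong {x} {x′} {y} {y′} x≈x′ y≈y′ = null⇒≈ℝ (null-resp-≗
  -- The difference of products is split so that each summand is a null sequence times a Cauchy
  -- sequence.
  (λ n → solve 4 (λ a a′ b b′ →
             (a :- a′) :* b :+ (b :- b′) :* a′ := a :* b :- a′ :* b′)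
           refl (seq x n) (seq x′ n) (seq y n) (seq y′ n))
  (null-+ (null-*-cauchy (≈ℝ⇒null x≈x′) (cauchy y))
          (null-*-cauchy (≈ℝ⇒null y≈y′) (cauchy x′))))

-- The ring of complex numbers.

ℂ-commutativeRing : CommutativeRing 0ℓ 0ℓ
ℂ-commutativeRing = record
  { Carrier = ℂ
  ; _≈_     = _≈_
  ; _+_     = _+_
  ; _*_     = _*_
  ; -_      = -_
  ; 0#      = 0ℂ
  ; 1#      = 1ℂ
  ; isCommutativeRing = record
    { isRing = record
      { +-isAbelianGroup = record
        { isGroup = record
          { isMonoid = record
            { isSemigroup = record
              { isMagma = record
                { isEquivalence = record
                  { refl  = mk≈ℂ ≈ℝ-refl ≈ℝ-refl
                  ; sym   = λ (mk≈ℂ p q) → mk≈ℂ (≈ℝ-sym p) (≈ℝ-sym q)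
                  ; trans = λ (mk≈ℂ p q) (mk≈ℂ p′ q′) →
                      mk≈ℂ (≈ℝ-trans p p′) (≈ℝ-trans q q′)
                  }
                ; ∙-cong = λ (mk≈ℂ p q) (mk≈ℂ p′ q′) →
                    mk≈ℂ (+ℝ-cong p p′) (+ℝ-cong q q′)
                }
              ; assoc = λ x y z → mk≈ℂ
                  (pointwise λ n → ℚ.+-assoc (seq (re x) n) (seq (re y) n) (seq (re z) n))
                  (pointwise λ n → ℚ.+-assoc (seq (im x) n) (seq (im y) n) (seq (im z) n))
              }
            ; identity =
                (λ x → mk≈ℂ (pointwise λ n → ℚ.+-identityˡ (seq (re x) n))
                            (pointwise λ n → ℚ.+-identityˡ (seq (im x) n))) ,
                (λ x → mk≈ℂ (pointwise λ n → ℚ.+-identityʳ (seq (re x) n))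
                            (pointwise λ n → ℚ.+-identityʳ (seq (im x) n)))
            }
          ; inverse =
              (λ x → mk≈ℂ (pointwise λ n → ℚ.+-inverseˡ (seq (re x) n))
                          (pointwise λ n → ℚ.+-inverseˡ (seq (im x) n))) ,
              (λ x → mk≈ℂ (pointwise λ n → ℚ.+-inverseʳ (seq (re x) n))
                          (pointwise λ n → ℚ.+-inverseʳ (seq (im x) n)))
          ; ⁻¹-cong = λ (mk≈ℂ p q) → mk≈ℂ (-ℝ-cong p) (-ℝ-cong q)
          }
        ; comm = λ x y → mk≈ℂ
            (pointwise λ n → ℚ.+-comm (seq (re x) n) (seq (re y) n))
            (pointwise λ n → ℚ.+-comm (seq (im x) n) (seq (im y) n))
        }
      ; *-cong = λ (mk≈ℂ p q) (mk≈ℂ p′ q′) → mk≈ℂ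
          (+ℝ-cong (*ℝ-cong p p′) (-ℝ-cong (*ℝ-cong q q′)))
          (+ℝ-cong (*ℝ-cong p q′) (*ℝ-cong q p′))
      ; *-assoc = λ x y z → mk≈ℂ
          (pointwise λ n → solve 6 (λ a b c d e f →
             (a :* c :+ :- (b :* d)) :* e :+ :- ((a :* d :+ b :* c) :* f)
               := a :* (c :* e :+ :- (d :* f)) :+ :- (b :* (c :* f :+ d :* e)))
             refl (seq (re x) n) (seq (im x) n) (seq (re y) n)
                  (seq (im y) n) (seq (re z) n) (seq (im z) n))
          (pointwise λ n → solve 6 (λ a b c d e f →
             (a :* c :+ :- (b :* d)) :* f :+ (a :* d :+ b :* c) :* e
               := a :* (c :* f :+ d :* e) :+ b :* (c :* e :+ :- (d :* f)))
             refl (seq (re x) n) (seq (im x) n) (seq (re y) n)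
                  (seq (im y) n) (seq (re z) n) (seq (im z) n))
      ; *-identity =
          (λ x → mk≈ℂ
            (pointwise λ n → solve 2 (λ a b →
               con 1ℚ :* a :+ :- (con 0ℚ :* b) := a) refl (seq (re x) n) (seq (im x) n))
            (pointwise λ n → solve 2 (λ a b →
               con 1ℚ :* b :+ con 0ℚ :* a := b) refl (seq (re x) n) (seq (im x) n))) ,
          (λ x → mk≈ℂ
            (pointwise λ n → solve 2 (λ a b →
               a :* con 1ℚ :+ :- (b :* con 0ℚ) := a) refl (seq (re x) n) (seq (im x) n))
            (pointwise λ n → solve 2 (λ a b →
               a :* con 0ℚ :+ b :* con 1ℚ := b) refl (seq (re x) n) (seq (im x) n)))
      ; distrib =
          (λ x y z → mk≈ℂ
            (pointwise λ n → solve 6 (λ a b c d e f →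
               a :* (c :+ e) :+ :- (b :* (d :+ f))
                 := (a :* c :+ :- (b :* d)) :+ (a :* e :+ :- (b :* f)))
               refl (seq (re x) n) (seq (im x) n) (seq (re y) n)
                    (seq (im y) n) (seq (re z) n) (seq (im z) n))
            (pointwise λ n → solve 6 (λ a b c d e f →
               a :* (d :+ f) :+ b :* (c :+ e)
                 := (a :* d :+ b :* c) :+ (a :* f :+ b :* e))
               refl (seq (re x) n) (seq (im x) n) (seq (re y) n)
                    (seq (im y) n) (seq (re z) n) (seq (im z) n))) ,
          (λ x y z → mk≈ℂ
            (pointwise λ n → solve 6 (λ a b c d e f →
               (c :+ e) :* a :+ :- ((d :+ f) :* b)
                 := (c :* a :+ :- (d :* b)) :+ (e :* a :+ :- (f :* b)))
               refl (seq (re x) n) (seq (im x) n) (seq (re y) n)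
                    (seq (im y) n) (seq (re z) n) (seq (im z) n))
            (pointwise λ n → solve 6 (λ a b c d e f →
               (c :+ e) :* b :+ (d :+ f) :* a
                 := (c :* b :+ d :* a) :+ (e :* b :+ f :* a))
               refl (seq (re x) n) (seq (im x) n) (seq (re y) n)
                    (seq (im y) n) (seq (re z) n) (seq (im z) n)))
      }
    ; *-comm = λ x y → mk≈ℂ
        (pointwise λ n → solve 4 (λ a b c d →
           a :* c :+ :- (b :* d) := c :* a :+ :- (d :* b))
           refl (seq (re x) n) (seq (im x) n) (seq (re y) n) (seq (im y) n))
        (pointwise λ n → solve 4 (λ a b c d →
           a :* d :+ b :* c := c :* b :+ d :* a)
           refl (seq (re x) n) (seq (im x) n) (seq (re y) n) (seq (im y) n))
    }
  }

module Cx = CommutativeRing ℂ-commutativeRing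
open SemiringSum Cx.semiring using (sum-cong-≋; sum-replicate-zero; ∑-comm;
  *-distribˡ-sum; *-distribʳ-sum)
module *-Properties = CommutativeSemigroupProperties Cx.*-commutativeSemigroup
open SetoidReasoning Cx.setoid

-- Conjugation and the Hermitian inner product.

conj-cong : ∀ {z w} → z ≈ w → conj z ≈ conj w
conj-cong (mk≈ℂ p q) = mk≈ℂ p (-ℝ-cong q)

conj-0 : conj 0ℂ ≈ 0ℂ
conj-0 = mk≈ℂ ≈ℝ-refl (pointwise λ _ → refl)

conj-+ : ∀ z w → conj (z + w) ≈ conj z + conj w
conj-+ z w = mk≈ℂ ≈ℝ-refl
  (pointwise λ n → ℚ.neg-distrib-+ (seq (im z) n) (seq (im w) n))

conj-* : ∀ z w → conj (z * w) ≈ conj z * conj w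
conj-* z w = mk≈ℂ
  (pointwise λ n → solve 4 (λ a b c d →
     a :* c :+ :- (b :* d) := a :* c :+ :- ((:- b) :* (:- d)))
     refl (seq (re z) n) (seq (im z) n) (seq (re w) n) (seq (im w) n))
  (pointwise λ n → solve 4 (λ a b c d →
     :- (a :* d :+ b :* c) := a :* (:- d) :+ (:- b) :* c)
     refl (seq (re z) n) (seq (im z) n) (seq (re w) n) (seq (im w) n))

conj-conj : ∀ z → conj (conj z) ≈ z
conj-conj z = mk≈ℂ ≈ℝ-refl
  (pointwise λ n → solve 1 (λ a → :- (:- a) := a) refl (seq (im z) n))

conj-sum : ∀ {n} (f : Vector ℂ n) → conj (sum f) ≈ sum (conj ∘ f)
conj-sum {zero}  f = conj-0
conj-sum {suc n} f = Cx.trans (conj-+ (f zero) (sum (f ∘ suc)))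
  (Cx.+-congˡ (conj-sum (f ∘ suc)))

⟨⟩-conj : ∀ {n} (u v : Vector ℂ n) → conj ⟨ u , v ⟩ ≈ ⟨ v , u ⟩
⟨⟩-conj u v = begin
  conj ⟨ u , v ⟩
    ≈⟨ conj-sum (λ k → u k * conj (v k)) ⟩
  sum (λ k → conj (u k * conj (v k)))
    ≈⟨ sum-cong-≋ (λ k → begin
         conj (u k * conj (v k))          ≈⟨ conj-* (u k) (conj (v k)) ⟩
         conj (u k) * conj (conj (v k))   ≈⟨ Cx.*-congˡ (conj-conj (v k)) ⟩
         conj (u k) * v k                 ≈⟨ Cx.*-comm (conj (u k)) (v k) ⟩
         v k * conj (u k)                 ∎) ⟩
  ⟨ v , u ⟩ ∎

⊥-sym : ∀ {n} {u v : Vector ℂ n} → u ⊥ v → v ⊥ u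
⊥-sym {u = u} {v} u⊥v = begin
  ⟨ v , u ⟩        ≈⟨ ⟨⟩-conj u v ⟨
  conj ⟨ u , v ⟩   ≈⟨ conj-cong u⊥v ⟩
  conj 0ℂ          ≈⟨ conj-0 ⟩
  0ℂ               ∎

-- Complex numbers of modulus one.

𝕋⇒unit : ∀ {z} → 𝕋 z → z * conj z ≈ 1ℂ
𝕋⇒unit {z} (_ , 1≈∣z∣²) = mk≈ℂ
  (≈ℝ-trans (pointwise λ n → solve 2 (λ a b →
       a :* a :+ :- (b :* (:- b)) := a :* a :+ b :* b)
       refl (seq (re z) n) (seq (im z) n))
    (≈ℝ-trans (≈ℝ-sym 1≈∣z∣²) (pointwise λ _ → refl)))
  (pointwise λ n → solve 2 (λ a b → a :* (:- b) :+ b :* a := con 0ℚ)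
     refl (seq (re z) n) (seq (im z) n))

𝕋-1 : 𝕋 1ℂ
𝕋-1 = mk≤ℝ (λ ε 0<ε → 0 , λ _ _ →
        ℚ.<⇒≤ (ℚ.+-mono-< (ℚ.positive⁻¹ 1ℚ) 0<ε)) ,
      pointwise λ _ → refl

-- Multiplicativity of the squared modulus, that is, the two-square identity of Brahmagupta and
-- Fibonacci.
𝕋-* : ∀ {z w} → 𝕋 z → 𝕋 w → 𝕋 (z * w)
𝕋-* {z} {w} (0≤1 , 1≈∣z∣²) (_ , 1≈∣w∣²) = 0≤1 ,
  ≈ℝ-trans (pointwise λ _ → refl)
    (≈ℝ-trans (*ℝ-cong 1≈∣z∣² 1≈∣w∣²)
      (pointwise λ n → solve 4 (λ a b c d →
         (a :* a :+ b :* b) :* (c :* c :+ d :* d)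
           := (a :* c :+ :- (b :* d)) :* (a :* c :+ :- (b :* d))
              :+ (a :* d :+ b :* c) :* (a :* d :+ b :* c))
         refl (seq (re z) n) (seq (im z) n) (seq (re w) n) (seq (im w) n)))

𝕋-resp-≈ : ∀ {z w} → z ≈ w → 𝕋 z → 𝕋 w
𝕋-resp-≈ (mk≈ℂ p q) (0≤1 , 1≈∣z∣²) =
  0≤1 , ≈ℝ-trans 1≈∣z∣² (+ℝ-cong (*ℝ-cong p p) (*ℝ-cong q q))

-- Cancelling a positive integer.

fromℚ : ℚ → ℂ
fromℚ q = mkℝ (λ _ → q) (const-cauchy q) +i 0ℝ

fromℚ-cong : ∀ {p q} → p ≡ q → fromℚ p ≈ fromℚ q
fromℚ-cong refl = Cx.refl

fromℚ-+ : ∀ p q → fromℚ (p ℚ.+ q) ≈ fromℚ p + fromℚ q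
fromℚ-+ p q = mk≈ℂ (pointwise λ _ → refl) (pointwise λ _ → refl)

fromℚ-* : ∀ p q → fromℚ (p ℚ.* q) ≈ fromℚ p * fromℚ q
fromℚ-* p q = mk≈ℂ
  (pointwise λ _ → solve 2 (λ a b → a :* b := a :* b :+ :- (con 0ℚ :* con 0ℚ)) refl p q)
  (pointwise λ _ → solve 2 (λ a b → con 0ℚ := a :* con 0ℚ :+ con 0ℚ :* b) refl p q)

-- Identifying the multiple of one with a positive rational lets its inverse be taken in `ℚ`,
-- without division in `ℝ` or `ℂ`.
0<1+n·1 : ∀ n → ∃ λ q → 0ℚ ℚ.< q × suc n · 1ℂ ≈ fromℚ q
0<1+n·1 zero    = 1ℚ , ℚ.positive⁻¹ 1ℚ , mk≈ℂ (pointwise λ _ → refl) (pointwise λ _ → refl)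
0<1+n·1 (suc n) with 0<1+n·1 n
... | q , 0<q , n·1≈q = 1ℚ ℚ.+ q , ℚ.+-mono-< (ℚ.positive⁻¹ 1ℚ) 0<q ,
  Cx.trans (Cx.+-cong (mk≈ℂ (pointwise λ _ → refl) (pointwise λ _ → refl)) n·1≈q)
    (Cx.sym (fromℚ-+ 1ℚ q))

-- The index in `Fin n` excludes n = 0, where cancellation fails.
n·1-cancel : ∀ {n} → Fin n → ∀ {z} → (n · 1ℂ) * z ≈ 0ℂ → z ≈ 0ℂ
n·1-cancel {suc n} _ {z} nz≈0 with 0<1+n·1 n
-- Dividing 1 by `q` yields the inverse `q⁻¹`.
... | q , 0<q , n·1≈q with quotient 1ℚ (ℚ.positive⁻¹ 1ℚ) q 0<q
... | q⁻¹ , _ , qq⁻¹≡1 = begin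
  z                                  ≈⟨ Cx.*-identityˡ z ⟨
  1ℂ * z                             ≈⟨ Cx.*-congʳ inverse ⟨
  (fromℚ q⁻¹ * (suc n · 1ℂ)) * z     ≈⟨ Cx.*-assoc (fromℚ q⁻¹) (suc n · 1ℂ) z ⟩
  fromℚ q⁻¹ * ((suc n · 1ℂ) * z)     ≈⟨ Cx.*-congˡ nz≈0 ⟩
  fromℚ q⁻¹ * 0ℂ                     ≈⟨ Cx.zeroʳ (fromℚ q⁻¹) ⟩
  0ℂ                                 ∎
  where
  inverse : fromℚ q⁻¹ * (suc n · 1ℂ) ≈ 1ℂ
  inverse = begin
    fromℚ q⁻¹ * (suc n · 1ℂ)   ≈⟨ Cx.*-congˡ n·1≈q ⟩
    fromℚ q⁻¹ * fromℚ q        ≈⟨ fromℚ-* q⁻¹ q ⟨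
    fromℚ (q⁻¹ ℚ.* q)          ≈⟨ fromℚ-cong (trans (ℚ.*-comm q⁻¹ q) qq⁻¹≡1) ⟩
    1ℂ                         ∎

-- Finite sums and matrix products.

sum-zero : ∀ {n} {f : Vector ℂ n} → (∀ k → f k ≈ 0ℂ) → sum f ≈ 0ℂ
sum-zero {n} f≈0 = Cx.trans (sum-cong-≋ f≈0) (sum-replicate-zero n)

sum-single : ∀ {n} (f : Vector ℂ n) i → (∀ k → k ≢ i → f k ≈ 0ℂ) → sum f ≈ f i
sum-single f zero    off = Cx.trans
  (Cx.+-congˡ (sum-zero λ k → off (suc k) λ ())) (Cx.+-identityʳ (f zero))
sum-single f (suc i) off = Cx.trans
  (Cx.+-cong (off zero λ ()) (sum-single (f ∘ suc) i λ k k≢i → off (suc k) (k≢i ∘ suc-injective)))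
  (Cx.+-identityˡ (f (suc i)))

*ᴹ-assoc : ∀ {m n p q} (A : Matrix m n) (B : Matrix n p) (D : Matrix p q) →
           (A *ᴹ B) *ᴹ D ≈ᴹ A *ᴹ (B *ᴹ D)
*ᴹ-assoc A B D i j = begin
  sum (λ l → sum (λ k → A i k * B k l) * D l j)
    ≈⟨ sum-cong-≋ (λ l → *-distribʳ-sum (D l j) (λ k → A i k * B k l)) ⟩
  sum (λ l → sum (λ k → (A i k * B k l) * D l j))
    ≈⟨ ∑-comm (λ l k → (A i k * B k l) * D l j) ⟩
  sum (λ k → sum (λ l → (A i k * B k l) * D l j))
    ≈⟨ sum-cong-≋ (λ k → sum-cong-≋ λ l → Cx.*-assoc (A i k) (B k l) (D l j)) ⟩
  sum (λ k → sum (λ l → A i k * (B k l * D l j)))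
    ≈⟨ sum-cong-≋ (λ k → *-distribˡ-sum (A i k) (λ l → B k l * D l j)) ⟨
  sum (λ k → A i k * sum (λ l → B k l * D l j)) ∎

*ᴹ-zeroʳ : ∀ {m n p} (A : Matrix m n) {B : Matrix n p} →
           B ≈ᴹ (λ _ _ → 0ℂ) → A *ᴹ B ≈ᴹ (λ _ _ → 0ℂ)
*ᴹ-zeroʳ A B≈0 i j = sum-zero λ k → Cx.trans (Cx.*-congˡ (B≈0 k j)) (Cx.zeroʳ (A i k))

-- The product W B, where W is the diagonal matrix with diagonal `w`.
scaleRows : ∀ {m n} → Vector ℂ m → Matrix m n → Matrix m n
scaleRows w B i j = w i * B i j

-- Put X = A W B and let G be the Gram matrix of the columns of `A`. Then ν X = (A Aᴴ) X = A (Aᴴ X),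
-- while Aᴴ X = G W B = W G B = W Aᴴ (A B) = 0. The hypothesis on `(A ᴴ *ᴹ A) c d` is G W = W G read
-- entrywise.
weighted-orthogonality :
  ∀ {p n q} (ν : ℂ) (A : Matrix p n) (B : Matrix n q) (w : Vector ℂ n) →
  (∀ {z} → ν * z ≈ 0ℂ → z ≈ 0ℂ) →
  (∀ i → (A *ᴹ A ᴴ) i i ≈ ν) →
  (∀ i k → i ≢ k → (A *ᴹ A ᴴ) i k ≈ 0ℂ) →
  (∀ c d → (A ᴴ *ᴹ A) c d * w d ≈ w c * (A ᴴ *ᴹ A) c d) →
  A *ᴹ B ≈ᴹ (λ _ _ → 0ℂ) →
  A *ᴹ scaleRows w B ≈ᴹ (λ _ _ → 0ℂ)
weighted-orthogonality ν A B w ν-cancel diagonal off-diagonal commutes AB≈0 i j =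
  ν-cancel (begin
    ν * X i j
      ≈⟨ Cx.*-congʳ (diagonal i) ⟨
    (A *ᴹ A ᴴ) i i * X i j
      -- Since `A *ᴹ A ᴴ` is diagonal, only the term k = i survives.
      ≈⟨ sum-single (λ k → (A *ᴹ A ᴴ) i k * X k j) i (λ k k≢i → Cx.trans
           (Cx.*-congʳ (off-diagonal i k (k≢i ∘ sym))) (Cx.zeroˡ (X k j))) ⟨
    ((A *ᴹ A ᴴ) *ᴹ X) i j
      ≈⟨ *ᴹ-assoc A (A ᴴ) X i j ⟩
    (A *ᴹ (A ᴴ *ᴹ X)) i j
      ≈⟨ *ᴹ-zeroʳ A AᴴX≈0 i j ⟩
    0ℂ ∎)
  where
  X = A *ᴹ scaleRows w B
  G = A ᴴ *ᴹ A

  AᴴX≈0 : A ᴴ *ᴹ X ≈ᴹ (λ _ _ → 0ℂ)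
  AᴴX≈0 c l = begin
    (A ᴴ *ᴹ X) c l
      ≈⟨ *ᴹ-assoc (A ᴴ) A (scaleRows w B) c l ⟨
    sum (λ d → G c d * (w d * B d l))
      ≈⟨ sum-cong-≋ (λ d → begin
           G c d * (w d * B d l)   ≈⟨ Cx.*-assoc (G c d) (w d) (B d l) ⟨
           (G c d * w d) * B d l   ≈⟨ Cx.*-congʳ (commutes c d) ⟩
           (w c * G c d) * B d l   ≈⟨ Cx.*-assoc (w c) (G c d) (B d l) ⟩
           w c * (G c d * B d l)   ∎) ⟩
    sum (λ d → w c * (G c d * B d l))
      ≈⟨ *-distribˡ-sum (w c) (λ d → G c d * B d l) ⟨
    w c * (G *ᴹ B) c l
      ≈⟨ Cx.*-congˡ (Cx.trans (*ᴹ-assoc (A ᴴ) A B c l) (*ᴹ-zeroʳ (A ᴴ) AB≈0 c l)) ⟩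
    w c * 0ℂ
      ≈⟨ Cx.zeroʳ (w c) ⟩
    0ℂ ∎

-- The enumeration of a subset as a bijection.

elements-injective : ∀ {n} (S : Subset n) {k l} → elements S k ≡ elements S l → k ≡ l
elements-injective (inside  Vec.∷ S) {zero}  {zero}  _  = refl
elements-injective (inside  Vec.∷ S) {suc k} {suc l} eq =
  cong suc (elements-injective S (suc-injective eq))
elements-injective (outside Vec.∷ S) eq = elements-injective S (suc-injective eq)

elements-∈ : ∀ {n} (S : Subset n) k → elements S k ∈ S
elements-∈ (inside  Vec.∷ S) zero    = Vec.here
elements-∈ (inside  Vec.∷ S) (suc k) = Vec.there (elements-∈ S k)
elements-∈ (outside Vec.∷ S) k       = Vec.there (elements-∈ S k)

elements-surjective : ∀ {n} (S : Subset n) {x} → x ∈ S → ∃ λ k → elements S k ≡ x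
elements-surjective (inside  Vec.∷ S) {zero}  _   = zero , refl
elements-surjective (inside  Vec.∷ S) {suc x} x∈S with elements-surjective S (drop-there x∈S)
... | k , eq = suc k , cong suc eq
elements-surjective (outside Vec.∷ S) {suc x} x∈S with elements-surjective S (drop-there x∈S)
... | k , eq = k , cong suc eq

-- Scalar matrices and entrywise equal Hadamard matrices.

scalar-diagonal : ∀ {n} z (i : Fin n) → scalar z i i ≈ z
scalar-diagonal z i with i ≟ i
... | yes _  = Cx.refl
... | no i≢i = contradiction refl i≢i

scalar-off-diagonal : ∀ {n} z {i j : Fin n} → i ≢ j → scalar z i j ≈ 0ℂ
scalar-off-diagonal z {i} {j} i≢j with i ≟ j
... | yes i≡j = contradiction i≡j i≢j
... | no _    = Cx.refl

IsHadamard-resp-≈ᴹ : ∀ {n} {H K : Matrix n n} → H ≈ᴹ K → IsHadamard H → IsHadamard K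
IsHadamard-resp-≈ᴹ H≈K H-hadamard = record
  { entries = λ i j → 𝕋-resp-≈ (H≈K i j) (entries i j)
  ; HHᴴ≈nI  = λ i j → Cx.trans
      (sum-cong-≋ λ k → Cx.*-cong (Cx.sym (H≈K i k)) (conj-cong (Cx.sym (H≈K j k))))
      (HHᴴ≈nI i j)
  }
  where open IsHadamard H-hadamard

-- Weighting the columns within a set of rows.

rows : ∀ {m n} → Matrix m n → (R : Subset m) → Matrix ∣ R ∣ n
rows H R k = H (elements R k)

-- A common form of both modifications, with one weight per column and no reference to a partition.
reweight : ∀ {m n} → Matrix m n → Subset m → Vector ℂ n → Matrix m n
reweight H R w r c = if ⌊ r ∈? R ⌋ then w c * H r c else H r c

-- The assumption `separated` replaces the block structure: columns with different weights must be
-- orthogonal on the rows in `R`.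
module _ {n} {H : Matrix n n} (H-hadamard : IsHadamard H) (R : Subset n)
         (w : Vector ℂ n) (w∈𝕋 : ∀ c → 𝕋 (w c))
         (separated : ∀ c d → w c ≡ w d ⊎ column (rows H R) c ⊥ column (rows H R) d)
         where
  open IsHadamard H-hadamard

  private
    A : Matrix ∣ R ∣ n
    A = rows H R

    -- Either the two weights agree and the factors commute, or the Gram entry vanishes and both
    -- sides are zero.
    gram-commutes : ∀ c d → (A ᴴ *ᴹ A) c d * w d ≈ w c * (A ᴴ *ᴹ A) c d
    gram-commutes c d with separated c d
    ... | inj₁ wc≡wd rewrite wc≡wd = Cx.*-comm _ (w d)
    ... | inj₂ c⊥d = Cx.trans (Cx.trans (Cx.*-congʳ G≈0) (Cx.zeroˡ (w d)))
                       (Cx.sym (Cx.trans (Cx.*-congˡ G≈0) (Cx.zeroʳ (w c))))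
      where
      G≈0 : (A ᴴ *ᴹ A) c d ≈ 0ℂ
      -- After commuting the factors, the entry is the inner product of column `d` with column `c`,
      -- in the reverse of the order in `c⊥d`.
      G≈0 = Cx.trans (sum-cong-≋ λ k → Cx.*-comm (conj (A k c)) (A k d))
                     (⊥-sym {u = column A c} {column A d} c⊥d)

  reweighted-rows-⊥ : ∀ {r s} → r ∈ R → s ∉ R → (λ c → w c * H r c) ⊥ H s
  reweighted-rows-⊥ {r} {s} r∈R s∉R with elements-surjective R r∈R
  ... | k , refl = Cx.trans
    -- The weight moves from row `r` to the conjugate of row `s`, which makes the sum an entry of A
    -- W B.
    (sum-cong-≋ λ c → *-Properties.xy∙z≈y∙xz (w c) (A k c) (conj (H s c)))
    -- Here B is the single column of conjugates of row `s`, and `s` itself witnesses that n is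
    -- nonzero.
    (weighted-orthogonality (n · 1ℂ) A ((λ (_ : Fin 1) → H s) ᴴ) w (n·1-cancel s)
      (λ i → Cx.trans (HHᴴ≈nI (elements R i) (elements R i)) (scalar-diagonal _ (elements R i)))
      (λ i j i≢j → Cx.trans (HHᴴ≈nI (elements R i) (elements R j))
        (scalar-off-diagonal _ (i≢j ∘ elements-injective R)))
      gram-commutes
      (λ i _ → Cx.trans (HHᴴ≈nI (elements R i) s)
        (scalar-off-diagonal _ λ eq → s∉R (subst (_∈ R) eq (elements-∈ R i))))
      k zero)

  -- Pairs of rows are split by membership in `R`. Two rows outside are untouched, a mixed pair
  -- stays orthogonal by `reweighted-rows-⊥`, and for two rows inside the factors `w c * conj (w c)`
  -- equal one in each term.
  reweight-hadamard : IsHadamard (reweight H R w)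
  reweight-hadamard = record { entries = entries′ ; HHᴴ≈nI = HHᴴ≈nI′ }
    where
    entries′ : ∀ r c → 𝕋 (reweight H R w r c)
    entries′ r c with r ∈? R
    ... | yes _ = 𝕋-* {w c} {H r c} (w∈𝕋 c) (entries r c)
    ... | no  _ = entries r c

    HHᴴ≈nI′ : reweight H R w *ᴹ reweight H R w ᴴ ≈ᴹ scalar (n · 1ℂ)
    HHᴴ≈nI′ r s with r ∈? R | s ∈? R
    ... | no  _   | no  _   = HHᴴ≈nI r s
    ... | yes r∈R | no  s∉R = Cx.trans (reweighted-rows-⊥ r∈R s∉R)
      (Cx.sym (scalar-off-diagonal _ λ r≡s → s∉R (subst (_∈ R) r≡s r∈R)))
    ... | no  r∉R | yes s∈R = Cx.trans
      (⊥-sym {u = λ c → w c * H s c} {H r} (reweighted-rows-⊥ s∈R r∉R))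
      (Cx.sym (scalar-off-diagonal _ λ r≡s → r∉R (subst (_∈ R) (sym r≡s) s∈R)))
    ... | yes _   | yes _   = Cx.trans (sum-cong-≋ unit-cancels) (HHᴴ≈nI r s)
      where
      unit-cancels : ∀ c → (w c * H r c) * conj (w c * H s c) ≈ H r c * conj (H s c)
      unit-cancels c = begin
        (w c * H r c) * conj (w c * H s c)
          ≈⟨ Cx.*-congˡ (conj-* (w c) (H s c)) ⟩
        (w c * H r c) * (conj (w c) * conj (H s c))
          ≈⟨ *-Properties.interchange (w c) (H r c) (conj (w c)) (conj (H s c)) ⟩
        (w c * conj (w c)) * (H r c * conj (H s c))
          ≈⟨ Cx.*-congʳ (𝕋⇒unit (w∈𝕋 c)) ⟩
        1ℂ * (H r c * conj (H s c))
          ≈⟨ Cx.*-identityˡ _ ⟩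
        H r c * conj (H s c) ∎

-- Weights coming from a partition of the columns.

theorem6p3 : ∀ (n t : ℕ) (H : Matrix n n) → IsHadamard H →
    (C : Vector (Subset n) t) (C-partition : IsPartition C) →
    (R R₁ : Subset n) → IsPartition (R ∷ R₁ ∷ []) →
    (∀ i j → i ≢ j → ∀ k l →
    column (submatrix H R₁ (C i)) k ⊥ column (submatrix H R₁ (C j)) l) →
    (∀ (a : Vector ℂ t) → (∀ i → 𝕋 (a i)) →
    IsHadamard (scaleBlocks H R₁ C-partition a))
    × (∀ (i : Fin t) (z : ℂ) → 𝕋 z →
    IsHadamard (scaleBlock H R₁ (C i) z))
theorem6p3 n t H H-hadamard C C-partition R R₁ R-partition blocks-⊥ =
  -- With weights `a ∘ part`, `reweight` and `scaleBlocks` agree by definition.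
  (λ a a∈𝕋 → reweight-hadamard H-hadamard R₁ (a ∘ part) (a∈𝕋 ∘ part)
               (constant-on-parts a)) ,
  λ i z z∈𝕋 →
    -- Scaling one block is scaling all blocks with weight 1 off part `i`. The results agree only up
    -- to `≈ᴹ`, since an entry with weight 1 is `1ℂ * H r c`.
    let a = λ j → if ⌊ j ≟ i ⌋ then z else 1ℂ in
    IsHadamard-resp-≈ᴹ (single-block i z)
      (reweight-hadamard H-hadamard R₁ (a ∘ part) (unimodular i z z∈𝕋 ∘ part)
        (constant-on-parts a))
  where
  open IsPartition C-partition

  -- Columns in the same part share a weight. Columns in different parts are located inside their
  -- blocks, where `blocks-⊥` applies.
  constant-on-parts : ∀ (a : Vector ℂ t) c d →
    a (part c) ≡ a (part d) ⊎ column (rows H R₁) c ⊥ column (rows H R₁) d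
  constant-on-parts a c d with part c ≟ part d
  ... | yes eq = inj₁ (cong a eq)
  ... | no neq
    with elements-surjective (C (part c)) (proj₂ (covers c))
       | elements-surjective (C (part d)) (proj₂ (covers d))
  ... | k , k≡c | l , l≡d = inj₂ (subst₂
    (λ c′ d′ → column (rows H R₁) c′ ⊥ column (rows H R₁) d′) k≡c l≡d
    (blocks-⊥ (part c) (part d) neq k l))

  unimodular : ∀ i z → 𝕋 z → ∀ j → 𝕋 (if ⌊ j ≟ i ⌋ then z else 1ℂ)
  unimodular i z z∈𝕋 j with j ≟ i
  ... | yes _ = z∈𝕋
  ... | no  _ = 𝕋-1

  single-block : ∀ i z →
    scaleBlocks H R₁ C-partition (λ j → if ⌊ j ≟ i ⌋ then z else 1ℂ)
      ≈ᴹ scaleBlock H R₁ (C i) z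
  single-block i z r c with r ∈? R₁ | part c ≟ i | c ∈? C i
  ... | no  _ | _        | _        = Cx.refl
  ... | yes _ | yes _    | yes _    = Cx.refl
  ... | yes _ | no  _    | no  _    = Cx.*-identityˡ (H r c)
  -- The two remaining cases are impossible: `c` lies in its own part, and by disjointness in no
  -- other.
  ... | yes _ | yes refl | no c∉C   = contradiction (proj₂ (covers c)) c∉C
  ... | yes _ | no neq   | yes c∈C  =
    contradiction (c , x∈p∩q⁺ (proj₂ (covers c) , c∈C)) (disjoint (part c) i neq)
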